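{- For every integer $n\ge 1$, the number of ordered set partitions of $[n]$ into exactly $n-1$ blocks that avoid the pattern $123$ is $$\operatorname{op}_{n,n-1}(123) = \frac{3(n-1)^2\binom{2n-2}{n-1}}{n(n+1)}.$$
   Context: An ordered set partition of $[n]$ into $k$ blocks is a sequence $B_1/B_2/\cdots/B_k$ of nonempty, pairwise disjoint subsets of $[n]$ whose union is $[n]$; the order of the blocks matters, but not the order of elements within a block. For a permutation $\rho=\rho_1\cdots\rho_m\in\mathcal{S}_m$, an ordered partition $B_1/\cdots/B_k$ contains $\rho$ if there are block indices $i_1<i_2<\cdots<i_m$ and elements $b_j\in B_{i_j}$ such that $b_1\cdots b_m$ is order-isomorphic to $\rho$ (i.e. $b_a<b_c$ iff $\rho_a<\rho_c$); otherwise it avoids $\rho$. $\operatorname{op}_{n,k}(\rho)$ denotes the number of ordered partitions of $[n]$ into $k$ blocks that avoid $\rho$ (so it is $0$ when $k=0<n$). -}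

module Defs where

open import Data.Bool using (true; false)
open import Data.Fin using (Fin; _<_)
open import Data.Fin.Permutation using (Permutation′; _⟨$⟩ʳ_; id)
open import Data.Fin.Properties using (any?; all?; _≟_; _<?_)
open import Data.Fin.Subset using (Subset; _∈_; _∩_; Nonempty; Empty)
open import Data.Fin.Subset.Properties using (nonempty?; _∈?_)
open import Data.List using (List; []; _∷_; length; filter; cartesianProductWith)
import Data.List.Membership.Propositional as List
open import Data.List.Membership.Propositional.Properties using (∈-cartesianProductWith⁺)
import Data.List.Relation.Unary.All as All
open import Data.List.Relation.Unary.Any using (here; there)
open import Data.List.Relation.Unary.AllPairs using ([]; _∷_)
open import Data.List.Relation.Unary.Unique.Propositional using (Unique)
open import Data.List.Relation.Unary.Unique.Propositional.Properties using (cartesianProductWith⁺)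
open import Data.Nat using (ℕ; zero; suc)
open import Data.Product using (_×_; _,_; ∃; ∃-syntax)
open import Data.Vec using (Vec; []; _∷_; lookup)
open import Data.Vec.Properties using (∷-injective)
open import Function using (_⇔_; mk⇔; Equivalence)
open import Relation.Binary.PropositionalEquality using (_≢_; refl)
open import Relation.Nullary using (¬_; Dec)
open import Relation.Nullary.Decidable using (map′; ¬?; _×-dec_; _→-dec_)
open import Relation.Unary using (Decidable)

private
  variable
    A : Set
    k m n : ℕ

-- The ground set [n] is Fin n, i.e. its elements are shifted down by one;
-- only their relative order matters.

record IsOrderedPartition (B : Vec (Subset n) k) : Set where
  field
    nonempty : ∀ i → Nonempty (lookup B i)
    disjoint : ∀ i j → i ≢ j → Empty (lookup B i ∩ lookup B j)
    covers   : ∀ x → ∃[ i ] x ∈ lookup B i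

Increasing : Vec (Fin k) m → Set
Increasing is = ∀ a c → a < c → lookup is a < lookup is c

OrderIsomorphic : Vec (Fin n) m → Permutation′ m → Set
OrderIsomorphic bs ρ = ∀ a c → (lookup bs a < lookup bs c) ⇔ ((ρ ⟨$⟩ʳ a) < (ρ ⟨$⟩ʳ c))

Contains : Permutation′ m → Vec (Subset n) k → Set
Contains {m} {n} {k} ρ B =
  ∃[ is ] ∃[ bs ]
    Increasing {k} {m} is ×
    (∀ j → lookup bs j ∈ lookup B (lookup is j)) ×
    OrderIsomorphic {n} {m} bs ρ

Avoids : Permutation′ m → Vec (Subset n) k → Set
Avoids ρ B = ¬ Contains ρ B

isOrderedPartition? : Decidable (IsOrderedPartition {n} {k})
isOrderedPartition? B = map′
  (λ (p , q , r) → record { nonempty = p ; disjoint = q ; covers = r })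
  (λ P → let open IsOrderedPartition P in nonempty , disjoint , covers)
  (all? (λ i → nonempty? (lookup B i))
   ×-dec all? (λ i → all? λ j → ¬? (i ≟ j) →-dec ¬? (nonempty? (lookup B i ∩ lookup B j)))
   ×-dec all? (λ x → any? λ i → x ∈? lookup B i))

anyVec? : {P : Vec (Fin n) m → Set} → Decidable P → Dec (∃ P)
anyVec? {m = zero}  P? = map′ ([] ,_) (λ { ([] , p) → p }) (P? [])
anyVec? {m = suc m} P? = map′
  (λ (x , xs , p) → x ∷ xs , p)
  (λ { (x ∷ xs , p) → x , xs , p })
  (any? λ x → anyVec? λ xs → P? (x ∷ xs))

increasing? : Decidable (Increasing {k} {m})
increasing? is = all? λ a → all? λ c → (a <? c) →-dec (lookup is a <? lookup is c)

orderIsomorphic? : (bs : Vec (Fin n) m) (ρ : Permutation′ m) → Dec (OrderIsomorphic bs ρ)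
orderIsomorphic? bs ρ = all? λ a → all? λ c →
  let b? = lookup bs a <? lookup bs c
      ρ? = (ρ ⟨$⟩ʳ a) <? (ρ ⟨$⟩ʳ c)
  in map′ (λ (f , g) → mk⇔ f g) (λ e → Equivalence.to e , Equivalence.from e)
          ((b? →-dec ρ?) ×-dec (ρ? →-dec b?))

contains? : (ρ : Permutation′ m) → Decidable (Contains {m} {n} {k} ρ)
contains? ρ B = anyVec? λ is → anyVec? λ bs →
  increasing? is
  ×-dec all? (λ j → lookup bs j ∈? lookup B (lookup is j))
  ×-dec orderIsomorphic? bs ρ

avoids? : (ρ : Permutation′ m) → Decidable (Avoids {m} {n} {k} ρ)
avoids? ρ B = ¬? (contains? ρ B)

vecs : List A → (k : ℕ) → List (Vec A k)
vecs xs zero    = [] ∷ []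
vecs xs (suc k) = cartesianProductWith _∷_ xs (vecs xs k)

subsets : (n : ℕ) → List (Subset n)
subsets n = vecs (true ∷ false ∷ []) n

op : (n k : ℕ) → Permutation′ m → ℕ
op n k ρ = length (filter (λ B → isOrderedPartition? B ×-dec avoids? ρ B) (vecs (subsets n) k))

pattern123 : Permutation′ 3
pattern123 = id

-- The candidates filtered in op list every k-tuple of subsets of [n] exactly
-- once, so op really is a cardinality.

∈-vecs : {xs : List A} → (∀ x → x List.∈ xs) → (v : Vec A k) → v List.∈ vecs xs k
∈-vecs all []      = here refl
∈-vecs all (x ∷ v) = ∈-cartesianProductWith⁺ _∷_ (all x) (∈-vecs all v)

vecs-unique : {xs : List A} → Unique xs → ∀ k → Unique (vecs xs k)
vecs-unique xs! zero    = All.[] ∷ []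
vecs-unique xs! (suc k) = cartesianProductWith⁺ _∷_ ∷-injective xs! (vecs-unique xs! k)

candidates-complete : (B : Vec (Subset n) k) → B List.∈ vecs (subsets n) k
candidates-complete = ∈-vecs (∈-vecs λ { true → here refl ; false → there (here refl) })

candidates-unique : ∀ n k → Unique (vecs (subsets n) k)
candidates-unique n k =
  vecs-unique (vecs-unique (((λ ()) All.∷ All.[]) ∷ All.[] ∷ []) n) k

{-# OPTIONS --safe #-}
module Submission where

-- Write each block in decreasing order.  An ordered partition with one block of
-- size two avoids 123 exactly when the resulting permutation does, so the count is
-- the total number of descents over all 123-avoiding permutations.  Reading from
-- left to right, the possible continuations depend only on the number b of unused
-- elements above some used one and the number a of the others.  The number of
-- continuations N(b,a) is the ballot number C(2a+b,a) - C(2a+b,a-1), and the number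
-- of ascents in them, A(b,a) = b C(2a+b-2,a-1) + C(2a+b-2,a-2), satisfies
-- A(b,a) = A(b+1,a-1) + A(b-1,a) + N(b-1,a-1) with A(0,a) = A(1,a-1).
-- The descents of all n-permutations number (n-1) N(0,n) - A(0,n).

open import Defs
open import Data.Nat using (ℕ; suc; NonZero; _*_; _∸_; _^_)
open import Data.Nat.Combinatorics using (_C_)
open import Data.Nat.Properties using (m*n≢0)
open import Data.Rational using (_/_)
open import Relation.Binary.PropositionalEquality using (_≡_)

open import Data.Fin as Fin using (Fin; zero; suc; _<_; opposite)
import Data.Fin.Permutation as Permutation
open import Data.Fin.Properties as Fin using (_≟_; <-cmp; <-trans; <-asym; <-irrefl; any?; opposite-prop; opposite-involutive; toℕ<n)
open import Data.Fin.Subset using (Subset; _∈_; _∉_; _∪_; ⁅_⁆; Nonempty)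
open import Data.Fin.Subset.Properties using (x∈⁅x⁆; x∈⁅y⁆⇒x≡y; x∈p∪q⁻; x∈p∪q⁺; ⊆-antisym; _∈?_; x∈p∩q⁺; x∈p∩q⁻)
import Data.Integer as ℤ
import Data.Integer.Properties as ℤ
open import Data.List using (List; []; _∷_; _++_; _∷ʳ_; length; map; concatMap; tabulate; filter)
open import Data.List.Membership.Propositional using (find; lose) renaming (_∈_ to _∈ˡ_; _∉_ to _∉ˡ_)
open import Data.List.Membership.Propositional.Properties using (∈-++⁺ˡ; ∈-++⁺ʳ; ∈-++⁻; ∈-∃++; ∈-map⁺; ∈-map⁻; ∈-insert; ∈-concatMap⁺; ∈-concatMap⁻; ∈-filter⁺; ∈-filter⁻; ∈-tabulate⁺)
open import Data.List.Membership.Propositional.Properties.WithK using (unique∧set⇒bag)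
open import Data.List.Properties using (length-++; length-++-sucʳ; length-map; length-tabulate; concatMap-map; concatMap-++; ++-assoc; ++-identityʳ; map-++; map-∘)
open import Data.List.Relation.Binary.BagAndSetEquality using (∼bag⇒↭)
open import Data.List.Relation.Binary.Disjoint.Propositional using (Disjoint)
open import Data.List.Relation.Binary.Permutation.Propositional.Properties using (↭-length)
open import Data.List.Relation.Unary.All as All using (All; []; _∷_)
import Data.List.Relation.Unary.All.Properties as All
open import Data.List.Relation.Unary.AllPairs as AllPairs using (AllPairs; []; _∷_)
import Data.List.Relation.Unary.AllPairs.Properties as AllPairs
open import Data.List.Relation.Unary.Any using (here; there)
open import Data.List.Relation.Unary.Unique.Propositional using (Unique)
import Data.List.Relation.Unary.Unique.Propositional.Properties as Unique
open import Data.Nat as ℕ using (zero; _+_; _≤_; z≤n; s≤s)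
open import Data.Nat.Combinatorics using (nCk≡nC[n∸k]; nCk+nC[k+1]≡[n+1]C[k+1])
open import Data.Nat.Combinatorics.Specification using (k>n⇒nCk≡0)
open import Data.Nat.Properties as ℕ using (+-identityʳ; +-assoc; +-comm; +-suc; suc-injective; *-distribˡ-+; +-cancelʳ-≡; *-zeroʳ; m≤m+n; m+n∸m≡n; n<1+n)
open import Data.Nat.Tactic.RingSolver using (solve-∀)
open import Data.Product using (∃-syntax; ∃₂; _×_; _,_; proj₁; proj₂)
open import Data.Rational.Properties using (fromℚᵘ-cong)
open import Data.Rational.Unnormalised using (mkℚᵘ; *≡*)
open import Data.Sum using (_⊎_; inj₁; inj₂; [_,_]′; swap)
open import Data.Vec using (Vec; []; _∷_; lookup)
open import Data.Vec.Properties using (∷-injectiveʳ)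
open import Function using (_∘_; id; _⇔_; mk⇔; Equivalence)
open import Relation.Binary.Definitions using (tri<; tri≈; tri>)
open import Relation.Binary.PropositionalEquality using (_≢_; refl; sym; trans; cong; cong₂; subst; subst₂; module ≡-Reasoning)
open import Relation.Nullary using (¬_; yes; no; contradiction)
open import Relation.Nullary.Decidable using (¬?; _×-dec_; decidable-stable)
open import Relation.Unary using (Decidable)
open ≡-Reasoning

-- Counting continuations

sumPicks sumSingles sumPickPairs sumDoubles : (ℕ → ℕ → ℕ) → ℕ → ℕ → ℕ
sumPicks f b zero    = 0
sumPicks f b (suc a) = f b a + sumPicks f (suc b) a
sumSingles f zero    a = sumPicks f 0 a
sumSingles f (suc b) a = f b a + sumPicks f (suc b) a
sumPickPairs f b zero    = 0
sumPickPairs f b (suc a) = sumPicks f b a + sumPickPairs f (suc b) a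
sumDoubles f zero    a = sumPickPairs f 0 a
sumDoubles f (suc b) a = sumSingles f b a + sumPickPairs f (suc b) a

-- b unused elements lie above some used one and a do not.  count₀ counts the
-- completions by k singleton blocks when b + a ≡ k, and count₁ those by k blocks,
-- one of them a pair, when b + a ≡ suc k; other arguments give junk values.
count₀ count₁ : ℕ → ℕ → ℕ → ℕ
count₀ zero    b a = 1
count₀ (suc k) b a = sumSingles (count₀ k) b a
count₁ zero    b a = 0
count₁ (suc k) b a = sumSingles (count₁ k) b a + sumDoubles (count₀ k) b a

infixl 6.5 _C₋_
-- The binomial coefficient with lower index k - 1. It vanishes at k = 0, where truncated
-- subtraction would give 1, so Pascal's rule holds for every k.
_C₋_ : ℕ → ℕ → ℕ
n C₋ zero  = 0
n C₋ suc k = n C k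

C₋-pascal : ∀ n k → suc n C k ≡ n C₋ k + n C k
C₋-pascal n zero    = refl
C₋-pascal n (suc k) = sym (nCk+nC[k+1]≡[n+1]C[k+1] n k)

C-middle : ∀ a → suc (a + a) C suc a ≡ suc (a + a) C a
C-middle a = trans (nCk≡nC[n∸k] (s≤s (m≤m+n a a))) (cong (suc (a + a) C_) (m+n∸m≡n a a))

b+2[1+a]≡2+b+2a : ∀ b a → b + (suc a + suc a) ≡ 2 + b + (a + a)
b+2[1+a]≡2+b+2a = solve-∀

-- The sum over choices telescopes: by computation alone N(b+1,a+1) = N(b,a+1) + N(b+2,a) and
-- N(0,a+1) = N(1,a), and Pascal's rule gives the ballot numbers the same recurrence. The subtracted
-- binomial stands on the left to stay within the naturals.
count₀-ballot : ∀ k b a → b + a ≡ k → count₀ k b a + (b + (a + a)) C₋ a ≡ (b + (a + a)) C a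
count₀-ballot zero    zero    zero    _  = refl
count₀-ballot (suc k) (suc b) zero    eq = begin
  count₀ k b 0 + 0 + 0     ≡⟨ cong (_+ 0) (+-identityʳ (count₀ k b 0)) ⟩
  count₀ k b 0 + 0         ≡⟨ count₀-ballot k b 0 (suc-injective eq) ⟩
  1                        ∎
count₀-ballot (suc k) zero    (suc a) eq rewrite +-suc a a = begin
  count₀ (suc k) 1 a + suc (suc (a + a)) C a
    ≡⟨ cong (count₀ (suc k) 1 a +_) (C₋-pascal (suc (a + a)) a) ⟩
  count₀ (suc k) 1 a + (M C₋ a + M C a)
    ≡⟨ +-assoc (count₀ (suc k) 1 a) _ _ ⟨
  count₀ (suc k) 1 a + M C₋ a + M C a
    ≡⟨ cong (_+ M C a) (count₀-ballot (suc k) 1 a eq) ⟩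
  M C a + M C a
    -- At b = 0 the row `M` is odd and its two middle entries agree, which yields the second term of
    -- Pascal's rule.
    ≡⟨ cong (λ x → M C a + x) (C-middle a) ⟨
  M C a + M C suc a
    ≡⟨ C₋-pascal M (suc a) ⟨
  suc M C suc a ∎
  where M = suc (a + a)
count₀-ballot (suc k) (suc b) (suc a) eq = begin
  count₀ k b (suc a) + n₂ + suc M C a
    ≡⟨ cong (count₀ k b (suc a) + n₂ +_) (C₋-pascal M a) ⟩
  count₀ k b (suc a) + n₂ + (M C₋ a + M C a)
    ≡⟨ rearrange (count₀ k b (suc a)) n₂ (M C₋ a) (M C a) ⟩
  (n₂ + M C₋ a) + (count₀ k b (suc a) + M C a)
    ≡⟨ cong₂ _+_ ih₂ (count₀-ballot k b (suc a) (suc-injective eq)) ⟩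
  M C a + M C suc a
    ≡⟨ C₋-pascal M (suc a) ⟨
  suc M C suc a ∎
  where
  M = b + (suc a + suc a)
  n₂ = count₀ (suc k) (suc (suc b)) a
  ih₂ : n₂ + M C₋ a ≡ M C a
  ih₂ = subst (λ m → n₂ + m C₋ a ≡ m C a) (sym (b+2[1+a]≡2+b+2a b a))
          (count₀-ballot (suc k) (suc (suc b)) a (trans (cong suc (sym (+-suc b a))) eq))
  rearrange : ∀ w x y z → w + x + (y + z) ≡ (x + y) + (w + z)
  rearrange = solve-∀

-- The total number of ascents of the permutations counted by count₀; their
-- descents are counted by count₁.
ascents : ℕ → ℕ → ℕ
ascents b zero    = 0
ascents b (suc a) = b * ((b + (a + a)) C a) + (b + (a + a)) C₋ a

ascents-ground : ∀ a → ascents 0 (suc (suc a)) ≡ ascents 1 (suc a)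
ascents-ground a rewrite +-suc a a = begin
  suc M C a            ≡⟨ C₋-pascal M a ⟩
  M C₋ a + M C a       ≡⟨ +-comm (M C₋ a) _ ⟩
  M C a + M C₋ a       ≡⟨ cong (_+ M C₋ a) (+-identityʳ (M C a)) ⟨
  M C a + 0 + M C₋ a   ∎
  where M = suc (a + a)

-- By the ballot formula, (b+1) C(2a+b,a) equals A(b,a+1) + N(b,a), so this is the recurrence for A
-- with N eliminated.
ascents-step : ∀ b a →
  ascents (suc b) (suc a) ≡ suc b * ((b + (a + a)) C a) + ascents (2 + b) a
ascents-step b zero    = refl
ascents-step b (suc a) rewrite b+2[1+a]≡2+b+2a b a = begin
  suc b * (suc M C suc a) + suc M C a
    ≡⟨ cong₂ (λ x y → suc b * x + y) (C₋-pascal M (suc a)) (C₋-pascal M a) ⟩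
  suc b * (M C a + M C suc a) + (M C₋ a + M C a)
    ≡⟨ rearrange b (M C a) (M C suc a) (M C₋ a) ⟩
  suc b * (M C suc a) + ((2 + b) * (M C a) + M C₋ a) ∎
  where
  M = suc (suc (b + (a + a)))
  rearrange : ∀ b x y z → suc b * (x + y) + (z + x) ≡ suc b * y + ((2 + b) * x + z)
  rearrange = solve-∀

-- Pairs starting with the top element contribute the first sum on the right. The others match the
-- pairs of the state (b+2,a), except for the pair of its two topmost elements, which accounts for
-- `f b a`.
sumDoubles-step : ∀ f b a →
  sumDoubles f (suc b) (suc a) + f b a ≡ sumSingles f b (suc a) + sumDoubles f (2 + b) a
sumDoubles-step f b a = rearrange (sumSingles f b (suc a)) (sumPicks f (suc b) a) (sumPickPairs f (2 + b) a) (f b a)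
  where
  rearrange : ∀ x y z w → x + (y + z) + w ≡ x + (w + y + z)
  rearrange = solve-∀

-- A permutation of k + 1 elements has k adjacent positions, each an ascent or a descent, and
-- merging the two elements of a descent gives the pair. The proof is by induction along the
-- recurrences.
count₁-ascents : ∀ k b a → b + a ≡ suc k → count₁ k b a + ascents b a ≡ k * count₀ (suc k) b a
count₁-ascents zero (suc zero) zero    eq = refl
count₁-ascents zero zero (suc zero)    eq = refl
count₁-ascents zero (suc zero) (suc a) ()
count₁-ascents zero (suc (suc b)) a    ()
count₁-ascents (suc k) (suc b) zero    eq = begin
  count₁ k b 0 + 0 + (n₁ + 0) + 0   ≡⟨ rearrange₁ (count₁ k b 0) n₁ ⟩
  n₁ + (count₁ k b 0 + 0)           ≡⟨ cong (n₁ +_) (count₁-ascents k b 0 (suc-injective eq)) ⟩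
  n₁ + k * n₁                       ≡⟨ cong (suc k *_) (+-identityʳ n₁) ⟨
  suc k * (n₁ + 0)                  ∎
  where
  n₁ = count₀ (suc k) b 0
  rearrange₁ : ∀ x y → x + 0 + (y + 0) + 0 ≡ y + (x + 0)
  rearrange₁ = solve-∀
count₁-ascents (suc k) zero    (suc (suc a)) eq =
  -- Both counts at (0,a+2) compute to those at (1,a+1), so only the ascents need an argument.
  trans (cong (count₁ (suc k) 1 (suc a) +_) (ascents-ground a)) (count₁-ascents (suc k) 1 (suc a) eq)
count₁-ascents (suc k) (suc b) (suc a) eq = begin
  s + t + ascents (suc b) (suc a)
    ≡⟨ cong (s + t +_) (ascents-step b a) ⟩
  s + t + (suc b * c + ascents (2 + b) a)
    -- One of the b + 1 copies of `c` is split into `n₀ + c₋`: `n₀` is what `sumDoubles-step` asks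
    -- for, and `c₋` completes A(b,a+1).
    ≡⟨ cong (λ x → s + t + (x + b * c + ascents (2 + b) a)) (count₀-ballot k b a b+a≡k) ⟨
  s + t + (n₀ + c₋ + b * c + ascents (2 + b) a)
    ≡⟨ rearrange₁ (count₁ k b (suc a)) s′ t n₀ c₋ (b * c) (ascents (2 + b) a) ⟩
  (count₁ k b (suc a) + (b * c + c₋)) + (s′ + (t + n₀) + ascents (2 + b) a)
    ≡⟨ cong₂ (λ x y → x + (s′ + y + ascents (2 + b) a)) (count₁-ascents k b (suc a) (suc-injective eq)) (sumDoubles-step (count₀ k) b a) ⟩
  k * n₁ + (s′ + (n₁ + t′) + ascents (2 + b) a)
    ≡⟨ rearrange₂ (k * n₁) s′ n₁ t′ (ascents (2 + b) a) ⟩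
  suc k * n₁ + (s′ + t′ + ascents (2 + b) a)
    ≡⟨ cong (suc k * n₁ +_) (count₁-ascents (suc k) (2 + b) a (trans (cong suc (sym (+-suc b a))) eq)) ⟩
  suc k * n₁ + suc k * n₂
    ≡⟨ *-distribˡ-+ (suc k) n₁ n₂ ⟨
  suc k * (n₁ + n₂) ∎
  where
  b+a≡k : b + a ≡ k
  b+a≡k = suc-injective (trans (sym (+-suc b a)) (suc-injective eq))
  c = (b + (a + a)) C a
  c₋ = (b + (a + a)) C₋ a
  s = sumSingles (count₁ k) (suc b) (suc a)
  s′ = sumSingles (count₁ k) (2 + b) a
  t = sumDoubles (count₀ k) (suc b) (suc a)
  t′ = sumDoubles (count₀ k) (2 + b) a
  n₀ = count₀ k b a
  n₁ = count₀ (suc k) b (suc a)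
  n₂ = count₀ (2 + k) (2 + b) a
  rearrange₁ : ∀ d s t n c x y → d + s + t + (n + c + x + y) ≡ (d + (x + c)) + (s + (t + n) + y)
  rearrange₁ = solve-∀
  rearrange₂ : ∀ x s n t y → x + (s + (n + t) + y) ≡ n + x + (s + t + y)
  rearrange₂ = solve-∀

-- Closed form for the number of descents

-- The ratio of consecutive entries of a row, by Pascal's rule and induction. Here `j` stands for n
-- + 1 - k without a subtraction.
C-absorb : ∀ n j k → j + k ≡ suc n → k * (n C k) ≡ j * (n C₋ k)
C-absorb n       j       zero    _    = sym (*-zeroʳ j)
C-absorb n       zero    (suc k) refl =
  trans (cong (suc k *_) (k>n⇒nCk≡0 (n<1+n n))) (*-zeroʳ (suc k))
C-absorb zero    (suc j) (suc k) eq with () ← trans (sym (+-suc j k)) (suc-injective eq)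
C-absorb (suc n) (suc j) (suc k) eq = begin
  suc k * (suc n C suc k)
    ≡⟨ cong (suc k *_) (C₋-pascal n (suc k)) ⟩
  suc k * (n C k + n C suc k)
    ≡⟨ expand k (n C k) (n C suc k) ⟩
  k * (n C k) + (n C k + suc k * (n C suc k))
    ≡⟨ cong₂ (λ x y → x + (n C k + y))
         (C-absorb n (suc j) k (trans (sym (+-suc j k)) (suc-injective eq)))
         (C-absorb n j (suc k) (suc-injective eq)) ⟩
  suc j * (n C₋ k) + (n C k + j * (n C k))
    ≡⟨ *-distribˡ-+ (suc j) (n C₋ k) (n C k) ⟨
  suc j * (n C₋ k + n C k)
    ≡⟨ cong (suc j *_) (C₋-pascal n k) ⟨
  suc j * (suc n C k) ∎
  where
  expand : ∀ k x y → suc k * (x + y) ≡ k * x + (x + suc k * y)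
  expand = solve-∀

-- The ballot formula at b = 0 is a Catalan number, here carried from row 2m + 4 down to row 2m + 2,
-- the row of the final binomial.
count₀-catalan : ∀ m → count₀ (2 + m) 0 (2 + m) + (suc m + suc m) C₋ m ≡ (suc m + suc m) C suc m
count₀-catalan m = +-cancelʳ-≡ (C₁ + (C₁ + C₀)) _ _ (begin
  n + C₂ + (C₁ + (C₁ + C₀))      ≡⟨ regroup n C₂ C₁ C₀ ⟩
  n + (C₂ + C₁ + (C₁ + C₀))      ≡⟨ cong (n +_) (cong₂ _+_ (C₋-pascal M m) (C₋-pascal M (suc m))) ⟨
  n + (suc M C m + suc M C suc m) ≡⟨ cong (n +_) (C₋-pascal (suc M) (suc m)) ⟨
  n + suc (suc M) C suc m        ≡⟨ subst (λ x → n + x C suc m ≡ x C suc (suc m)) (cong suc (+-suc (suc m) (suc m))) (count₀-ballot (2 + m) 0 (2 + m) refl) ⟩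
  suc (suc M) C suc (suc m)      ≡⟨ C₋-pascal (suc M) (2 + m) ⟩
  suc M C suc m + suc M C (2 + m) ≡⟨ cong (λ x → suc M C suc m + x) (C-middle (suc m)) ⟩
  suc M C suc m + suc M C suc m  ≡⟨ cong₂ _+_ (C₋-pascal M (suc m)) (C₋-pascal M (suc m)) ⟩
  C₁ + C₀ + (C₁ + C₀)            ≡⟨ regroup′ C₁ C₀ ⟩
  C₀ + (C₁ + (C₁ + C₀))          ∎)
  where
  M = suc m + suc m
  n = count₀ (2 + m) 0 (2 + m)
  C₀ = M C suc m
  C₁ = M C m
  C₂ = M C₋ m
  regroup : ∀ n x y z → n + x + (y + (y + z)) ≡ n + (x + y + (y + z))
  regroup = solve-∀
  regroup′ : ∀ y z → y + z + (y + z) ≡ z + (y + (y + z))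
  regroup′ = solve-∀

count₁-closed : ∀ m → suc m * (2 + m) * count₁ m 0 (suc m) ≡ 3 * m ^ 2 * ((m + m) C m)
count₁-closed zero = refl
-- The added term is cancelled at the end. By absorption its first half completes `d` with the
-- ascents `c₁`, and its second half completes `n` with `c₂`.
count₁-closed (suc m) = +-cancelʳ-≡ ((2 + s) * (s * c) + s * (m * (s * c))) _ _ (begin
  suc s * (2 + s) * d + ((2 + s) * (s * c) + s * (m * (s * c)))
    ≡⟨ cong (λ x → suc s * (2 + s) * d + ((2 + s) * x + s * (m * x))) (C-absorb M (suc s) s refl) ⟩
  suc s * (2 + s) * d + ((2 + s) * (suc s * c₁) + s * (m * (suc s * c₁)))
    ≡⟨ regroup₁ s m d c₁ ⟩
  suc s * (2 + s) * (d + c₁) + s * suc s * (m * c₁)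
    ≡⟨ cong₂ (λ x y → suc s * (2 + s) * x + s * suc s * y)
         (count₁-ascents s 0 (suc s) refl)
         (C-absorb M (2 + s) m (cong suc (sym (+-suc s m)))) ⟩
  suc s * (2 + s) * (s * n) + s * suc s * ((2 + s) * c₂)
    ≡⟨ regroup₂ s n c₂ ⟩
  suc s * (2 + s) * s * (n + c₂)
    ≡⟨ cong (suc s * (2 + s) * s *_) (count₀-catalan m) ⟩
  suc s * (2 + s) * s * c
    ≡⟨ regroup₃ m c ⟩
  3 * s ^ 2 * c + ((2 + s) * (s * c) + s * (m * (s * c))) ∎)
  where
  s = suc m
  M = s + s
  d = count₁ s 0 (suc s)
  n = count₀ (suc s) 0 (suc s)
  c = M C s
  c₁ = M C m
  c₂ = M C₋ m
  regroup₁ : ∀ s m d c → suc s * (2 + s) * d + ((2 + s) * (suc s * c) + s * (m * (suc s * c)))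
    ≡ suc s * (2 + s) * (d + c) + s * suc s * (m * c)
  regroup₁ = solve-∀
  regroup₂ : ∀ s n c → suc s * (2 + s) * (s * n) + s * suc s * ((2 + s) * c)
    ≡ suc s * (2 + s) * s * (n + c)
  regroup₂ = solve-∀
  regroup₃ : ∀ m c → (2 + m) * (3 + m) * suc m * c
    ≡ 3 * (suc m * (suc m * 1)) * c + ((3 + m) * (suc m * c) + suc m * (m * (suc m * c)))
  regroup₃ = solve-∀

-- Enumerating the continuations

private
  variable
    A K : Set
    k n : ℕ

Choice : ℕ → Set → Set
Choice n K = K × List (Fin n) × List (Fin n)

-- The unused elements are kept as a descending list hi ++ lo, where hi holds
-- those lying above some element of an earlier block.  To avoid 123, an element
-- of hi may be used only when it is the largest unused element; an element of lo
-- may always be used, and every unused element above it then moves to hi.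
picks singles : List (Fin n) → List (Fin n) → List (Choice n (Fin n))
picks hi []       = []
picks hi (x ∷ lo) = (x , hi , lo) ∷ picks (hi ∷ʳ x) lo
singles []       lo = picks [] lo
singles (h ∷ hi) lo = (h , hi , lo) ∷ picks (h ∷ hi) lo

-- A pair is read off with its larger element first.
withFirst : Fin n → List (Choice n (Fin n)) → List (Choice n (Fin n × Fin n))
withFirst y = map λ (x , hi , lo) → (y , x) , hi , lo

-- Since the larger element comes first, a low first element forces a low second one, and a high
-- first element must be the top.
pickPairs doubles : List (Fin n) → List (Fin n) → List (Choice n (Fin n × Fin n))
pickPairs hi []       = []
pickPairs hi (y ∷ lo) = withFirst y (picks hi lo) ++ pickPairs (hi ∷ʳ y) lo
doubles []       lo = pickPairs [] lo
doubles (h ∷ hi) lo = withFirst h (singles hi lo) ++ pickPairs (h ∷ hi) lo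

pair : Fin n × Fin n → Subset n
pair (y , x) = ⁅ y ⁆ ∪ ⁅ x ⁆

extend : (K → Subset n) → (List (Fin n) → List (Fin n) → List (Vec (Subset n) k)) →
         List (Choice n K) → List (Vec (Subset n) (suc k))
extend block g = concatMap λ (c , hi , lo) → map (block c ∷_) (g hi lo)

gen₀ gen₁ : ∀ k → List (Fin n) → List (Fin n) → List (Vec (Subset n) k)
gen₀ zero    hi lo = [] ∷ []
gen₀ (suc k) hi lo = extend ⁅_⁆ (gen₀ k) (singles hi lo)
gen₁ zero    hi lo = []
gen₁ (suc k) hi lo = extend ⁅_⁆ (gen₁ k) (singles hi lo) ++ extend pair (gen₀ k) (doubles hi lo)

-- Lengths of the enumerations

length-∷ʳ : ∀ (xs : List A) x → length (xs ∷ʳ x) ≡ suc (length xs)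
length-∷ʳ xs x = trans (length-++ xs) (+-comm (length xs) 1)

module _ {g : List (Fin n) → List (Fin n) → List (Vec (Subset n) k)} {f : ℕ → ℕ → ℕ}
         (g-length : ∀ hi lo → length (g hi lo) ≡ f (length hi) (length lo)) where

  length-extend-∷ : ∀ (block : K → Subset n) c hi lo cs →
    length (extend block g ((c , hi , lo) ∷ cs)) ≡ f (length hi) (length lo) + length (extend block g cs)
  length-extend-∷ block c hi lo cs = trans (length-++ (map (block c ∷_) (g hi lo)))
    (cong (_+ length (extend block g cs)) (trans (length-map (block c ∷_) (g hi lo)) (g-length hi lo)))

  length-extend-++ : ∀ (block : K → Subset n) cs ds →
    length (extend block g (cs ++ ds)) ≡ length (extend block g cs) + length (extend block g ds)
  length-extend-++ block cs ds =
    trans (cong length (concatMap-++ _ cs ds)) (length-++ (extend block g cs))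

  length-extend-picks : ∀ (block : Fin n → Subset n) hi lo →
    length (extend block g (picks hi lo)) ≡ sumPicks f (length hi) (length lo)
  length-extend-picks block hi []       = refl
  length-extend-picks block hi (x ∷ lo) = trans (length-extend-∷ block x hi lo (picks (hi ∷ʳ x) lo))
    (cong (f (length hi) (length lo) +_) (trans (length-extend-picks block (hi ∷ʳ x) lo)
      (cong (λ b → sumPicks f b (length lo)) (length-∷ʳ hi x))))

  length-extend-singles : ∀ (block : Fin n → Subset n) hi lo →
    length (extend block g (singles hi lo)) ≡ sumSingles f (length hi) (length lo)
  length-extend-singles block []       lo = length-extend-picks block [] lo
  length-extend-singles block (h ∷ hi) lo = trans (length-extend-∷ block h hi lo (picks (h ∷ hi) lo))
    (cong (f (length hi) (length lo) +_) (length-extend-picks block (h ∷ hi) lo))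

  length-extend-withFirst : ∀ (block : Fin n × Fin n → Subset n) y cs →
    length (extend block g (withFirst y cs)) ≡ length (extend (block ∘ (y ,_)) g cs)
  length-extend-withFirst block y cs = cong length (concatMap-map _ _ cs)

  length-extend-pickPairs : ∀ (block : Fin n × Fin n → Subset n) hi lo →
    length (extend block g (pickPairs hi lo)) ≡ sumPickPairs f (length hi) (length lo)
  length-extend-pickPairs block hi []       = refl
  length-extend-pickPairs block hi (y ∷ lo) =
    trans (length-extend-++ block (withFirst y (picks hi lo)) (pickPairs (hi ∷ʳ y) lo)) (cong₂ _+_
      (trans (length-extend-withFirst block y (picks hi lo)) (length-extend-picks _ hi lo))
      (trans (length-extend-pickPairs block (hi ∷ʳ y) lo)
        (cong (λ b → sumPickPairs f b (length lo)) (length-∷ʳ hi y))))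

  length-extend-doubles : ∀ (block : Fin n × Fin n → Subset n) hi lo →
    length (extend block g (doubles hi lo)) ≡ sumDoubles f (length hi) (length lo)
  length-extend-doubles block []       lo = length-extend-pickPairs block [] lo
  length-extend-doubles block (h ∷ hi) lo =
    trans (length-extend-++ block (withFirst h (singles hi lo)) (pickPairs (h ∷ hi) lo)) (cong₂ _+_
      (trans (length-extend-withFirst block h (singles hi lo)) (length-extend-singles _ hi lo))
      (length-extend-pickPairs block (h ∷ hi) lo))

length-gen₀ : ∀ k (hi lo : List (Fin n)) → length (gen₀ k hi lo) ≡ count₀ k (length hi) (length lo)
length-gen₀ zero    hi lo = refl
length-gen₀ (suc k) hi lo = length-extend-singles (length-gen₀ k) ⁅_⁆ hi lo

length-gen₁ : ∀ k (hi lo : List (Fin n)) → length (gen₁ k hi lo) ≡ count₁ k (length hi) (length lo)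
length-gen₁ zero    hi lo = refl
length-gen₁ (suc k) hi lo = trans (length-++ (extend ⁅_⁆ (gen₁ k) (singles hi lo))) (cong₂ _+_
  (length-extend-singles (length-gen₁ k) ⁅_⁆ hi lo)
  (length-extend-doubles (length-gen₀ k) pair hi lo))

-- Choices as relations between states

-- Relational form of membership in `singles`, with the state before, the element used and the state
-- after as indices. In `low`, the skipped elements `l` become high.
data Single {n} : List (Fin n) → List (Fin n) → Fin n → List (Fin n) → List (Fin n) → Set where
  top : ∀ {h hi lo} → Single (h ∷ hi) lo h hi lo
  low : ∀ {hi} l {x lo} → Single hi (l ++ x ∷ lo) x (hi ++ l) lo

data Double {n} : List (Fin n) → List (Fin n) → Fin n × Fin n → List (Fin n) → List (Fin n) → Set where
  top : ∀ {h hi lo x hi′ lo′} → Single hi lo x hi′ lo′ → Double (h ∷ hi) lo (h , x) hi′ lo′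
  low : ∀ {hi} l₁ {y} l₂ {x lo} → Double hi (l₁ ++ y ∷ l₂ ++ x ∷ lo) (y , x) ((hi ++ l₁) ++ l₂) lo

-- Reduces facts about pairs to two successive single choices. The converse, `Double-exists`,
-- requires the second element to be smaller.
Double⇒Singles : ∀ {hi lo y x hi″ lo″} → Double {n} hi lo (y , x) hi″ lo″ →
  ∃₂ λ hi′ lo′ → Single hi lo y hi′ lo′ × Single hi′ lo′ x hi″ lo″
Double⇒Singles (top s)     = _ , _ , top , s
Double⇒Singles (low l₁ l₂) = _ , _ , low l₁ , low l₂

∷ʳ-++ : ∀ (xs : List A) x ys → (xs ∷ʳ x) ++ ys ≡ xs ++ x ∷ ys
∷ʳ-++ xs x ys = ++-assoc xs (x ∷ []) ys

picks-sound : ∀ (hi lo : List (Fin n)) {x hi′ lo′} → (x , hi′ , lo′) ∈ˡ picks hi lo →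
  ∃[ l ] lo ≡ l ++ x ∷ lo′ × hi′ ≡ hi ++ l
picks-sound hi (x ∷ lo) (here refl) = [] , refl , sym (++-identityʳ hi)
picks-sound hi (x ∷ lo) (there p) with l , refl , refl ← picks-sound (hi ∷ʳ x) lo p =
  x ∷ l , refl , ∷ʳ-++ hi x l

picks-complete : ∀ (hi l : List (Fin n)) x lo → (x , hi ++ l , lo) ∈ˡ picks hi (l ++ x ∷ lo)
picks-complete hi []      x lo = here (cong (λ h → x , h , lo) (++-identityʳ hi))
picks-complete hi (y ∷ l) x lo = there (subst (λ h → (x , h , lo) ∈ˡ picks (hi ∷ʳ y) (l ++ x ∷ lo))
  (∷ʳ-++ hi y l) (picks-complete (hi ∷ʳ y) l x lo))

singles-sound : ∀ (hi lo : List (Fin n)) {x hi′ lo′} →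
  (x , hi′ , lo′) ∈ˡ singles hi lo → Single hi lo x hi′ lo′
singles-sound []       lo p with l , refl , refl ← picks-sound [] lo p = low l
singles-sound (h ∷ hi) lo (here refl) = top
singles-sound (h ∷ hi) lo (there p) with l , refl , refl ← picks-sound (h ∷ hi) lo p = low l

singles-complete : ∀ {hi lo : List (Fin n)} {x hi′ lo′} →
  Single hi lo x hi′ lo′ → (x , hi′ , lo′) ∈ˡ singles hi lo
singles-complete top = here refl
singles-complete {hi = []}    (low l) = picks-complete [] l _ _
singles-complete {hi = _ ∷ _} (low l) = there (picks-complete _ l _ _)

withFirst⁻ : ∀ {y : Fin n} {y′ x hi lo} cs → ((y′ , x) , hi , lo) ∈ˡ withFirst y cs → y′ ≡ y × (x , hi , lo) ∈ˡ cs
withFirst⁻ cs p with _ , q , refl ← ∈-map⁻ _ p = refl , q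

pickPairs-sound : ∀ (hi lo : List (Fin n)) {y x hi′ lo′} → ((y , x) , hi′ , lo′) ∈ˡ pickPairs hi lo →
  ∃₂ λ l₁ l₂ → lo ≡ l₁ ++ y ∷ l₂ ++ x ∷ lo′ × hi′ ≡ (hi ++ l₁) ++ l₂
pickPairs-sound hi (y ∷ lo) p with ∈-++⁻ (withFirst y (picks hi lo)) p
... | inj₁ q with refl , r ← withFirst⁻ (picks hi lo) q with l , refl , refl ← picks-sound hi lo r =
  [] , l , refl , cong (_++ l) (sym (++-identityʳ hi))
... | inj₂ q with l₁ , l₂ , refl , refl ← pickPairs-sound (hi ∷ʳ y) lo q =
  y ∷ l₁ , l₂ , refl , cong (_++ l₂) (∷ʳ-++ hi y l₁)

pickPairs-complete : ∀ (hi l₁ : List (Fin n)) y l₂ x lo →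
  ((y , x) , (hi ++ l₁) ++ l₂ , lo) ∈ˡ pickPairs hi (l₁ ++ y ∷ l₂ ++ x ∷ lo)
pickPairs-complete hi [] y l₂ x lo rewrite ++-identityʳ hi =
  ∈-++⁺ˡ (∈-map⁺ _ (picks-complete hi l₂ x lo))
pickPairs-complete hi (z ∷ l₁) y l₂ x lo rewrite sym (∷ʳ-++ hi z l₁) =
  ∈-++⁺ʳ (withFirst z (picks hi (l₁ ++ y ∷ l₂ ++ x ∷ lo))) (pickPairs-complete (hi ∷ʳ z) l₁ y l₂ x lo)

doubles-sound : ∀ (hi lo : List (Fin n)) {c hi′ lo′} →
  (c , hi′ , lo′) ∈ˡ doubles hi lo → Double hi lo c hi′ lo′
doubles-sound []       lo p with l₁ , l₂ , refl , refl ← pickPairs-sound [] lo p = low l₁ l₂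
doubles-sound (h ∷ hi) lo p with ∈-++⁻ (withFirst h (singles hi lo)) p
... | inj₁ q with refl , r ← withFirst⁻ (singles hi lo) q = top (singles-sound hi lo r)
... | inj₂ q with l₁ , l₂ , refl , refl ← pickPairs-sound (h ∷ hi) lo q = low l₁ l₂

doubles-complete : ∀ {hi lo : List (Fin n)} {c hi′ lo′} →
  Double hi lo c hi′ lo′ → (c , hi′ , lo′) ∈ˡ doubles hi lo
doubles-complete (top s) = ∈-++⁺ˡ (∈-map⁺ _ (singles-complete s))
doubles-complete {hi = []}     (low l₁ l₂) = pickPairs-complete [] l₁ _ l₂ _ _
doubles-complete {hi = h ∷ hi} (low l₁ l₂) =
  ∈-++⁺ʳ (withFirst h (singles hi _)) (pickPairs-complete (h ∷ hi) l₁ _ l₂ _ _)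

-- Removing the first block

Descending : List (Fin n) → Set
Descending = AllPairs Fin._>_

-- hi′ and lo′ are what is left of hi and lo once the block X has been used.
record Move {n} (hi lo : List (Fin n)) (X : Subset n) (hi′ lo′ : List (Fin n)) : Set where
  field
    nonempty : Nonempty X
    block⊆   : ∀ {z} → z ∈ X → z ∈ˡ hi ++ lo
    rest⊆    : ∀ {z} → z ∈ˡ hi′ ++ lo′ → z ∈ˡ hi ++ lo
    rest∉    : ∀ {z} → z ∈ˡ hi′ ++ lo′ → z ∉ X
    split    : ∀ {z} → z ∈ˡ hi ++ lo → z ∈ X ⊎ z ∈ˡ hi′ ++ lo′
    high     : ∀ {z} → z ∈ˡ hi′ → z ∈ˡ hi ⊎ ∃[ x ] x ∈ X × x < z
    low∉     : ∀ {z} → z ∈ˡ lo′ → z ∉ˡ hi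
    low<     : ∀ {z x} → z ∈ˡ lo′ → x ∈ X → z < x
    block>   : ∀ {x z} → x ∈ X → x ∈ˡ hi → z ∈ˡ hi′ ++ lo′ → z < x

++-descending : ∀ (xs {ys} : List (Fin n)) → Descending (xs ++ ys) →
  ∀ {x y} → x ∈ˡ xs → y ∈ˡ ys → y < x
++-descending (x ∷ xs) (ps ∷ _)  (here refl) q = All.lookup ps (∈-++⁺ʳ xs q)
++-descending (x ∷ xs) (_  ∷ pp) (there p)   q = ++-descending xs pp p q

drop-middle : ∀ (xs : List (Fin n)) {x ys} → Descending (xs ++ x ∷ ys) → Descending (xs ++ ys)
drop-middle []       (_ ∷ d)  = d
drop-middle (z ∷ xs) (ps ∷ d) =
  All.++⁺ (All.++⁻ˡ xs ps) (All.tail (All.++⁻ʳ xs ps)) ∷ drop-middle xs d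

∈-middle : ∀ (xs : List A) {x ys z} → z ∈ˡ xs ++ x ∷ ys → z ≡ x ⊎ z ∈ˡ xs ++ ys
∈-middle []       (here p)  = inj₁ p
∈-middle []       (there p) = inj₂ p
∈-middle (w ∷ xs) (here p)  = inj₂ (here p)
∈-middle (w ∷ xs) (there p) = [ inj₁ , inj₂ ∘ there ]′ (∈-middle xs p)

∈-middle⁺ : ∀ (xs : List A) {x ys z} → z ∈ˡ xs ++ ys → z ∈ˡ xs ++ x ∷ ys
∈-middle⁺ xs p = [ ∈-++⁺ˡ , ∈-++⁺ʳ xs ∘ there ]′ (∈-++⁻ xs p)

middle∉ : ∀ (xs : List (Fin n)) {x ys z} → Descending (xs ++ x ∷ ys) → z ∈ˡ xs ++ ys → z ≢ x
middle∉ xs d p refl with ∈-++⁻ xs p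
... | inj₁ q = <-irrefl refl (++-descending xs d q (here refl))
middle∉ []       (ps ∷ _) p refl | inj₂ q = <-irrefl refl (All.lookup ps q)
middle∉ (w ∷ xs) (_ ∷ d)  p refl | inj₂ q = middle∉ xs d (∈-++⁺ʳ xs q) refl

Single-descending : ∀ {hi lo : List (Fin n)} {x hi′ lo′} → Single hi lo x hi′ lo′ →
  Descending (hi ++ lo) → Descending (hi′ ++ lo′)
Single-descending top (_ ∷ d) = d
Single-descending {hi = hi} (low l {x} {lo}) d =
  drop-middle (hi ++ l) (subst Descending (sym (++-assoc hi l (x ∷ lo))) d)

Single-length : ∀ {hi lo : List (Fin n)} {x hi′ lo′} → Single hi lo x hi′ lo′ →
  length (hi ++ lo) ≡ suc (length (hi′ ++ lo′))
Single-length top = refl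
Single-length {hi = hi} (low l {x} {lo}) =
  trans (cong length (sym (++-assoc hi l (x ∷ lo)))) (length-++-sucʳ (hi ++ l) x lo)

Single-move : ∀ {hi lo : List (Fin n)} {x hi′ lo′} → Single hi lo x hi′ lo′ →
  Descending (hi ++ lo) → Move hi lo ⁅ x ⁆ hi′ lo′
Single-move {hi = h ∷ hi} {lo} top (ps ∷ d) = record
  { nonempty = h , x∈⁅x⁆ h
  ; block⊆   = λ z∈ → here (x∈⁅y⁆⇒x≡y h z∈)
  ; rest⊆    = there
  ; rest∉    = λ p z∈ → <-irrefl (x∈⁅y⁆⇒x≡y h z∈) (All.lookup ps p)
  ; split    = λ { (here refl) → inj₁ (x∈⁅x⁆ h) ; (there p) → inj₂ p }
  ; high     = inj₁ ∘ there
  ; low∉     = λ p q → <-irrefl refl (++-descending (h ∷ hi) (ps ∷ d) q p)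
  ; low<     = λ { p x∈ → subst (_ <_) (sym (x∈⁅y⁆⇒x≡y h x∈)) (All.lookup ps (∈-++⁺ʳ hi p)) }
  ; block>   = λ { x∈ _ p → subst (_ <_) (sym (x∈⁅y⁆⇒x≡y h x∈)) (All.lookup ps p) }
  }
Single-move {hi = hi} (low l {x} {lo}) d = record
  { nonempty = x , x∈⁅x⁆ x
  ; block⊆   = λ z∈ → subst (_∈ˡ hi ++ l ++ x ∷ lo) (sym (x∈⁅y⁆⇒x≡y x z∈)) (from (∈-insert (hi ++ l)))
  ; rest⊆    = from ∘ ∈-middle⁺ (hi ++ l)
  ; rest∉    = λ p z∈ → middle∉ (hi ++ l) d′ p (x∈⁅y⁆⇒x≡y x z∈)
  ; split    = λ p → [ (λ { refl → inj₁ (x∈⁅x⁆ x) }) , inj₂ ]′ (∈-middle (hi ++ l) (to p))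
  ; high     = λ p → inj₂ (x , x∈⁅x⁆ x , ++-descending (hi ++ l) d′ p (here refl))
  ; low∉     = λ p q → <-irrefl refl (++-descending hi d q (∈-++⁺ʳ l (there p)))
  ; low<     = λ p x∈ → subst (_ <_) (sym (x∈⁅y⁆⇒x≡y x x∈)) (below p)
  ; block>   = λ x∈ p _ → contradiction (subst (_∈ˡ hi) (x∈⁅y⁆⇒x≡y x x∈) p)
                 (λ q → <-irrefl refl (++-descending hi d q (∈-insert l)))
  }
  where
  d′ = subst Descending (sym (++-assoc hi l (x ∷ lo))) d
  to : ∀ {z} → z ∈ˡ hi ++ l ++ x ∷ lo → z ∈ˡ (hi ++ l) ++ x ∷ lo
  to = subst (_ ∈ˡ_) (sym (++-assoc hi l (x ∷ lo)))
  from : ∀ {z} → z ∈ˡ (hi ++ l) ++ x ∷ lo → z ∈ˡ hi ++ l ++ x ∷ lo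
  from = subst (_ ∈ˡ_) (++-assoc hi l (x ∷ lo))
  below : ∀ {z} → z ∈ˡ lo → z < x
  below p = ++-descending ((hi ++ l) ∷ʳ x) (subst Descending (sym (∷ʳ-++ (hi ++ l) x lo)) d′)
              (∈-insert (hi ++ l)) p

-- What is low after the second move was already low after the first, and an element of `Y` high at
-- the start is still high in between. Hence the two blocks act as one.
Move-trans : ∀ {hi lo : List (Fin n)} {X hi′ lo′ Y hi″ lo″} →
  Move hi lo X hi′ lo′ → Move hi′ lo′ Y hi″ lo″ → Move hi lo (X ∪ Y) hi″ lo″
Move-trans {hi = hi} {lo} {X} {hi′} {lo′} {Y} {hi″} {lo″} m m′ = record
  { nonempty = let x , x∈ = M.nonempty in x , x∈p∪q⁺ (inj₁ x∈)
  ; block⊆   = λ z∈ → [ M.block⊆ , M.rest⊆ ∘ M′.block⊆ ]′ (x∈p∪q⁻ X Y z∈)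
  ; rest⊆    = M.rest⊆ ∘ M′.rest⊆
  ; rest∉    = λ p z∈ → [ M.rest∉ (M′.rest⊆ p) , M′.rest∉ p ]′ (x∈p∪q⁻ X Y z∈)
  ; split    = λ p → [ inj₁ ∘ x∈p∪q⁺ ∘ inj₁ , (λ q → [ inj₁ ∘ x∈p∪q⁺ ∘ inj₂ , inj₂ ]′ (M′.split q)) ]′ (M.split p)
  ; high     = λ p → [ (λ q → [ inj₁ , (λ (x , x∈ , x<) → inj₂ (x , x∈p∪q⁺ (inj₁ x∈) , x<)) ]′ (M.high q))
                     , (λ (x , x∈ , x<) → inj₂ (x , x∈p∪q⁺ (inj₂ x∈) , x<)) ]′ (M′.high p)
  ; low∉     = λ p → M.low∉ (stillLow p)
  ; low<     = λ p x∈ → [ M.low< (stillLow p) , M′.low< p ]′ (x∈p∪q⁻ X Y x∈)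
  ; block>   = λ x∈ x∈hi p → [ (λ x∈X → M.block> x∈X x∈hi (M′.rest⊆ p))
                             , (λ x∈Y → M′.block> x∈Y (stillHigh x∈Y x∈hi) p) ]′ (x∈p∪q⁻ X Y x∈)
  }
  where
  module M = Move m
  module M′ = Move m′
  stillLow : ∀ {z} → z ∈ˡ lo″ → z ∈ˡ lo′
  stillLow p with ∈-++⁻ hi′ (M′.rest⊆ (∈-++⁺ʳ hi″ p))
  ... | inj₁ q = contradiction q (M′.low∉ p)
  ... | inj₂ q = q
  stillHigh : ∀ {x} → x ∈ Y → x ∈ˡ hi → x ∈ˡ hi′
  stillHigh x∈Y x∈hi with ∈-++⁻ hi′ (M′.block⊆ x∈Y)
  ... | inj₁ q = q
  ... | inj₂ q = contradiction x∈hi (M.low∉ q)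

-- B is an ordered partition of hi ++ lo that can follow the earlier blocks: a 12
-- in B whose 1 lies in hi would complete a 123.
record Valid {n k} (hi lo : List (Fin n)) (B : Vec (Subset n) k) : Set where
  field
    nonempty : ∀ i → Nonempty (lookup B i)
    disjoint : ∀ i j → i ≢ j → ∀ {x} → x ∈ lookup B i → x ∉ lookup B j
    sound    : ∀ i {x} → x ∈ lookup B i → x ∈ˡ hi ++ lo
    covers   : ∀ {x} → x ∈ˡ hi ++ lo → ∃[ i ] x ∈ lookup B i
    no12     : ∀ {i j x y} → i < j → x ∈ lookup B i → y ∈ lookup B j → x < y → x ∉ˡ hi
    no123    : ∀ {i j l x y z} → i < j → j < l →
               x ∈ lookup B i → y ∈ lookup B j → z ∈ lookup B l → x < y → ¬ y < z

module _ {hi lo : List (Fin n)} {X hi′ lo′} {B : Vec (Subset n) k} (m : Move hi lo X hi′ lo′) where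
  private module M = Move m

  -- High elements of `X` exceed all that remains, so none is the 1 of a 12. In a 123 starting in
  -- `X`, the 2 exceeds an element of `X`, hence is high afterwards, which validity of `B` excludes.
  Valid-∷⁺ : Valid hi′ lo′ B → Valid hi lo (X ∷ B)
  Valid-∷⁺ v = record
    { nonempty = λ { zero → M.nonempty ; (suc i) → V.nonempty i }
    ; disjoint = λ { zero zero i≢j _ _ → i≢j refl
                   ; zero (suc j) _ p q → M.rest∉ (V.sound j q) p
                   ; (suc i) zero _ p q → M.rest∉ (V.sound i p) q
                   ; (suc i) (suc j) i≢j p q → V.disjoint i j (i≢j ∘ cong suc) p q }
    ; sound    = λ { zero p → M.block⊆ p ; (suc i) p → M.rest⊆ (V.sound i p) }
    ; covers   = λ p → [ zero ,_ , (λ q → let i , r = V.covers q in suc i , r) ]′ (M.split p)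
    ; no12     = no12
    ; no123    = no123
    }
    where
    module V = Valid v
    no12 : ∀ {i j x y} → i < j → x ∈ lookup (X ∷ B) i → y ∈ lookup (X ∷ B) j → x < y → x ∉ˡ hi
    no12 {zero}  {suc j} _ p q x<y r = <-asym x<y (M.block> p r (V.sound j q))
    no12 {suc i} {suc j} (s≤s i<j) p q x<y r with ∈-++⁻ hi′ (V.sound i p)
    ... | inj₁ s = V.no12 i<j p q x<y s
    ... | inj₂ s = M.low∉ s r
    no123 : ∀ {i j l x y z} → i < j → j < l → x ∈ lookup (X ∷ B) i →
      y ∈ lookup (X ∷ B) j → z ∈ lookup (X ∷ B) l → x < y → ¬ y < z
    no123 {zero} {suc j} {suc l} _ (s≤s j<l) p q r x<y y<z with ∈-++⁻ hi′ (V.sound j q)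
    ... | inj₁ s = V.no12 j<l q r y<z s
    ... | inj₂ s = <-asym x<y (M.low< s p)
    no123 {suc i} {suc j} {suc l} (s≤s i<j) (s≤s j<l) = V.no123 i<j j<l

  -- An element that has just become high lies above some element of `X`, so a 12 starting at it
  -- would extend to a 123.
  Valid-∷⁻ : Valid hi lo (X ∷ B) → Valid hi′ lo′ B
  Valid-∷⁻ v = record
    { nonempty = V.nonempty ∘ suc
    ; disjoint = λ i j i≢j → V.disjoint (suc i) (suc j) (i≢j ∘ Fin.suc-injective)
    ; sound    = λ i p → [ (λ q → contradiction p (V.disjoint zero (suc i) (λ ()) q)) , id ]′ (M.split (V.sound (suc i) p))
    ; covers   = covers
    ; no12     = λ i<j p q x<y r → [ V.no12 (s≤s i<j) p q x<y
                 , (λ (_ , w∈ , w<) → V.no123 ℕ.z<s (s≤s i<j) w∈ p q w< x<y) ]′ (M.high r)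
    ; no123    = λ i<j j<l → V.no123 (s≤s i<j) (s≤s j<l)
    }
    where
    module V = Valid v
    covers : ∀ {x} → x ∈ˡ hi′ ++ lo′ → ∃[ i ] x ∈ lookup B i
    covers p with V.covers (M.rest⊆ p)
    ... | zero  , q = contradiction q (M.rest∉ p)
    ... | suc i , q = i , q

-- Sizes of the blocks by counting

∈-remove : ∀ {x : A} {xs} → x ∈ˡ xs →
  ∃[ xs′ ] length xs ≡ suc (length xs′) × (∀ {z} → z ∈ˡ xs → z ≢ x → z ∈ˡ xs′)
∈-remove {x = x} p with ys , zs , refl ← ∈-∃++ p =
  ys ++ zs , length-++-sucʳ ys x zs ,
  λ q z≢x → [ (λ z≡x → contradiction z≡x z≢x) , id ]′ (∈-middle ys q)

-- Deleting one element of each block from `xs` in turn leaves the later blocks intact, by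
-- disjointness.
packing : ∀ (B : Vec (Subset n) k) {xs} → (∀ i → Nonempty (lookup B i)) →
  (∀ i j → i ≢ j → ∀ {x} → x ∈ lookup B i → x ∉ lookup B j) →
  (∀ i {x} → x ∈ lookup B i → x ∈ˡ xs) → k ≤ length xs
packing []      ne dis sub = z≤n
packing (X ∷ B) ne dis sub with x , x∈X ← ne zero with xs′ , eq , keep ← ∈-remove (sub zero x∈X) =
  subst (_ ≤_) (sym eq) (s≤s (packing B (ne ∘ suc)
    (λ i j i≢j → dis (suc i) (suc j) (i≢j ∘ Fin.suc-injective))
    (λ i z∈ → keep (sub (suc i) z∈) λ { refl → dis zero (suc i) (λ ()) x∈X z∈ })))

-- The elements `ws` of the first block `X` are deleted before the other blocks are packed. Applied
-- to two or three elements, this bounds the size of `X`.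
packing-∷ : ∀ {X} (B : Vec (Subset n) k) {xs} ws → Unique ws → All (_∈ X) ws → All (_∈ˡ xs) ws →
  (∀ i → Nonempty (lookup B i)) →
  (∀ i j → i ≢ j → ∀ {x} → x ∈ lookup B i → x ∉ lookup B j) →
  (∀ i {x} → x ∈ lookup B i → x ∈ˡ xs) → (∀ i {x} → x ∈ lookup B i → x ∉ X) →
  length ws + k ≤ length xs
packing-∷ B []       _ _ _ ne dis sub _ = packing B ne dis sub
packing-∷ B (w ∷ ws) (w≢ ∷ u) (w∈X ∷ ∈X) (w∈xs ∷ ∈xs) ne dis sub new
  with xs′ , eq , keep ← ∈-remove w∈xs =
  subst (_ ≤_) (sym eq) (s≤s (packing-∷ B ws u ∈X
    (All.zipWith (λ (p , w≢z) → keep p (w≢z ∘ sym)) (∈xs , w≢)) ne dis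
    (λ i z∈ → keep (sub i z∈) λ { refl → new i z∈ w∈X }) new))

Valid-packing : ∀ {hi lo X} {B : Vec (Subset n) k} → Valid hi lo (X ∷ B) →
  ∀ ws → Unique ws → All (_∈ X) ws → length ws + k ≤ length (hi ++ lo)
Valid-packing {B = B} v ws u ∈X = packing-∷ B ws u ∈X (All.map (V.sound zero) ∈X) (V.nonempty ∘ suc)
  (λ i j i≢j → V.disjoint (suc i) (suc j) (i≢j ∘ Fin.suc-injective))
  (V.sound ∘ suc) (λ i p q → V.disjoint zero (suc i) (λ ()) q p)
  where module V = Valid v

-- An element outside `X` lies in a later block, so if it exceeded `x` the two would form a
-- forbidden 12 with high 1.
Valid-top : ∀ {hi lo X x z} {B : Vec (Subset n) k} → Valid hi lo (X ∷ B) →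
  x ∈ X → x ∈ˡ hi → z ∈ˡ hi ++ lo → z ∉ X → z < x
Valid-top {x = x} {z} v x∈X x∈hi z∈ z∉X with Valid.covers v z∈
... | zero  , z∈X = contradiction z∈X z∉X
... | suc i , z∈B with <-cmp z x
...   | tri< z<x _ _  = z<x
...   | tri≈ _ refl _ = contradiction x∈X z∉X
...   | tri> _ _ x<z  = contradiction x∈hi (Valid.no12 v ℕ.z<s x∈X z∈B x<z)

-- A low element can always be used. A high one must be the head of the descending list, since
-- otherwise the head contradicts its maximality.
Single-exists : ∀ {hi lo : List (Fin n)} {x} → Descending (hi ++ lo) → x ∈ˡ hi ++ lo →
  (x ∈ˡ hi → ∀ {z} → z ∈ˡ hi ++ lo → z ≢ x → z < x) → ∃₂ λ hi′ lo′ → Single hi lo x hi′ lo′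
Single-exists {hi = hi} d p top-max with ∈-++⁻ hi p
... | inj₂ q with l , lo′ , refl ← ∈-∃++ q = _ , _ , low l
Single-exists d p top-max | inj₁ (here refl) = _ , _ , top
Single-exists {hi = h ∷ hi} {x = x} (ps ∷ d) p top-max | inj₁ (there q) =
  contradiction (top-max (there q) (here refl) (λ h≡x → <-irrefl (sym h≡x) x<h)) (<-asym x<h)
  where
  x<h : x < h
  x<h = All.lookup ps (∈-++⁺ˡ q)

Double-exists : ∀ {hi lo : List (Fin n)} {y x hi′ lo′ hi″ lo″} → Descending (hi ++ lo) → x < y →
  Single hi lo y hi′ lo′ → Single hi′ lo′ x hi″ lo″ → Double hi lo (y , x) hi″ lo″
Double-exists d x<y top s = top s
Double-exists d x<y (low l₁) s = after-low l₁ d x<y s refl refl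
  where
  -- The intermediate state is generalised to variables with equations, since `hi ++ l₁` cannot be
  -- unified with the indices of `Single`. A `top` choice here would take an element above `y`.
  after-low : ∀ {hi lo : List (Fin n)} {y x hi′ lo′ hi″ lo″} l₁ → Descending (hi ++ l₁ ++ y ∷ lo) → x < y →
    Single hi′ lo′ x hi″ lo″ → hi′ ≡ hi ++ l₁ → lo′ ≡ lo → Double hi (l₁ ++ y ∷ lo) (y , x) hi″ lo″
  after-low {hi = hi} {lo} {y} l₁ d x<y top eq refl =
    contradiction (++-descending (hi ++ l₁) (subst Descending (sym (++-assoc hi l₁ (y ∷ lo))) d)
      (subst (_ ∈ˡ_) eq (here refl)) (here refl)) (<-asym x<y)
  after-low l₁ d x<y (low l₂) refl refl = low l₁ l₂

Double-move : ∀ {hi lo : List (Fin n)} {c hi′ lo′} → Double hi lo c hi′ lo′ →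
  Descending (hi ++ lo) → Move hi lo (pair c) hi′ lo′
Double-move dd d with _ , _ , s , s′ ← Double⇒Singles dd =
  Move-trans (Single-move s d) (Single-move s′ (Single-descending s d))

Double-descending : ∀ {hi lo : List (Fin n)} {c hi′ lo′} → Double hi lo c hi′ lo′ →
  Descending (hi ++ lo) → Descending (hi′ ++ lo′)
Double-descending dd d with _ , _ , s , s′ ← Double⇒Singles dd =
  Single-descending s′ (Single-descending s d)

Double-length : ∀ {hi lo : List (Fin n)} {c hi′ lo′} → Double hi lo c hi′ lo′ →
  length (hi ++ lo) ≡ 2 + length (hi′ ++ lo′)
Double-length dd with _ , _ , s , s′ ← Double⇒Singles dd =
  trans (Single-length s) (cong suc (Single-length s′))

Descending-++⁻ : ∀ (xs : List (Fin n)) {ys} → Descending (xs ++ ys) → Descending ys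
Descending-++⁻ []       d       = d
Descending-++⁻ (_ ∷ xs) (_ ∷ d) = Descending-++⁻ xs d

Double-< : ∀ {hi lo : List (Fin n)} {y x hi′ lo′} → Double hi lo (y , x) hi′ lo′ →
  Descending (hi ++ lo) → x < y
Double-< (top {hi = hi} {lo} {x} s) (ps ∷ d) = All.lookup ps (Move.block⊆ (Single-move s d) (x∈⁅x⁆ x))
Double-< {hi = hi} (low l₁ {y} l₂ {x} {lo}) d =
  ++-descending (l₁ ∷ʳ y) (subst Descending (sym (∷ʳ-++ l₁ y _)) (Descending-++⁻ hi d))
    (∈-insert l₁) (∈-insert l₂)

-- Soundness and completeness of the enumerations

extend⁺ : ∀ (block : K → Subset n) (g : List (Fin n) → List (Fin n) → List (Vec (Subset n) k)) {cs c hi lo B} →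
  (c , hi , lo) ∈ˡ cs → B ∈ˡ g hi lo → block c ∷ B ∈ˡ extend block g cs
extend⁺ block g p q = ∈-concatMap⁺ _ (lose p (∈-map⁺ (block _ ∷_) q))

extend⁻ : ∀ (block : K → Subset n) (g : List (Fin n) → List (Fin n) → List (Vec (Subset n) k)) {X B} cs →
  X ∷ B ∈ˡ extend block g cs →
  ∃[ c ] ∃₂ λ hi lo → (c , hi , lo) ∈ˡ cs × B ∈ˡ g hi lo × X ≡ block c
extend⁻ block g cs p with (c , hi , lo) , q , r ← find (∈-concatMap⁻ _ {xs = cs} p)
  with B , s , refl ← ∈-map⁻ (block c ∷_) r = c , hi , lo , q , s , refl

Valid-[] : Valid {n} [] [] []
Valid-[] = record
  { nonempty = λ () ; disjoint = λ () ; sound = λ () ; covers = λ ()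
  ; no12 = λ { {()} } ; no123 = λ { {()} } }

gen₀-sound : ∀ k (hi lo : List (Fin n)) {B} → Descending (hi ++ lo) → length (hi ++ lo) ≡ k →
  B ∈ˡ gen₀ k hi lo → Valid hi lo B
gen₀-sound zero    []      []      d eq (here refl) = Valid-[]
gen₀-sound zero    []      (_ ∷ _) d () p
gen₀-sound zero    (_ ∷ _) lo      d () p
gen₀-sound (suc k) hi lo {X ∷ B} d eq p
  with x , hi′ , lo′ , q , r , refl ← extend⁻ ⁅_⁆ (gen₀ k) (singles hi lo) p =
  Valid-∷⁺ (Single-move s d) (gen₀-sound k hi′ lo′ (Single-descending s d)
    (suc-injective (trans (sym (Single-length s)) eq)) r)
  where s = singles-sound hi lo q

gen₁-sound : ∀ k (hi lo : List (Fin n)) {B} → Descending (hi ++ lo) → length (hi ++ lo) ≡ suc k →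
  B ∈ˡ gen₁ k hi lo → Valid hi lo B
gen₁-sound (suc k) hi lo {X ∷ B} d eq p with ∈-++⁻ (extend ⁅_⁆ (gen₁ k) (singles hi lo)) p
... | inj₁ p₁ with x , hi′ , lo′ , q , r , refl ← extend⁻ ⁅_⁆ (gen₁ k) (singles hi lo) p₁ =
  let s = singles-sound hi lo q in
  Valid-∷⁺ (Single-move s d) (gen₁-sound k hi′ lo′ (Single-descending s d)
    (suc-injective (trans (sym (Single-length s)) eq)) r)
... | inj₂ p₂ with c , hi′ , lo′ , q , r , refl ← extend⁻ pair (gen₀ k) (doubles hi lo) p₂ =
  let s = doubles-sound hi lo q in
  Valid-∷⁺ (Double-move s d) (gen₀-sound k hi′ lo′ (Double-descending s d)
    (suc-injective (suc-injective (trans (sym (Double-length s)) eq))) r)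

≡⁅⁆ : ∀ {X : Subset n} {x} → x ∈ X → (∀ {z} → z ∈ X → z ≡ x) → X ≡ ⁅ x ⁆
≡⁅⁆ {X = X} {x} x∈X only = ⊆-antisym
  (λ z∈ → subst (_∈ ⁅ x ⁆) (sym (only z∈)) (x∈⁅x⁆ x))
  (λ z∈ → subst (_∈ X) (sym (x∈⁅y⁆⇒x≡y x z∈)) x∈X)

∈-pair⁻ : ∀ {y x z : Fin n} → z ∈ pair (y , x) → z ≡ y ⊎ z ≡ x
∈-pair⁻ {y = y} {x} z∈ =
  [ inj₁ ∘ x∈⁅y⁆⇒x≡y y , inj₂ ∘ x∈⁅y⁆⇒x≡y x ]′ (x∈p∪q⁻ ⁅ y ⁆ ⁅ x ⁆ z∈)

∈-pair₁ : ∀ (y x : Fin n) → y ∈ pair (y , x)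
∈-pair₁ y x = x∈p∪q⁺ (inj₁ (x∈⁅x⁆ y))

∈-pair₂ : ∀ (y x : Fin n) → x ∈ pair (y , x)
∈-pair₂ y x = x∈p∪q⁺ (inj₂ (x∈⁅x⁆ x))

≡pair : ∀ {X : Subset n} {y x} → y ∈ X → x ∈ X → (∀ {z} → z ∈ X → z ≡ y ⊎ z ≡ x) → X ≡ pair (y , x)
≡pair {X = X} {y} {x} y∈X x∈X only = ⊆-antisym
  (λ z∈ → [ (λ { refl → ∈-pair₁ y x }) , (λ { refl → ∈-pair₂ y x }) ]′ (only z∈))
  (λ z∈ → [ (λ { refl → y∈X }) , (λ { refl → x∈X }) ]′ (∈-pair⁻ z∈))

single-complete : ∀ {hi lo x} {B : Vec (Subset n) k} → Descending (hi ++ lo) → Valid hi lo (⁅ x ⁆ ∷ B) →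
  ∃₂ λ hi′ lo′ → Single hi lo x hi′ lo′
single-complete {x = x} d v = Single-exists d (Valid.sound v zero (x∈⁅x⁆ x))
  λ x∈hi z∈ z≢x → Valid-top v (x∈⁅x⁆ x) x∈hi z∈ (z≢x ∘ x∈⁅y⁆⇒x≡y x)

double-complete : ∀ {hi lo y x} {B : Vec (Subset n) k} → Descending (hi ++ lo) → x < y →
  Valid hi lo (pair (y , x) ∷ B) → ∃₂ λ hi′ lo′ → Double hi lo (y , x) hi′ lo′
double-complete {hi = hi} {lo} {y} {x} d x<y v =
  let _ , _ , s = Single-exists d (Valid.sound v zero (∈-pair₁ y x)) y-max
      module M = Move (Single-move s d)
      x∈rest = [ (λ x∈ → contradiction (x∈⁅y⁆⇒x≡y y x∈) (λ x≡y → <-irrefl x≡y x<y)) , id ]′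
                 (M.split (Valid.sound v zero (∈-pair₂ y x)))
      _ , _ , s′ = Single-exists (Single-descending s d) x∈rest λ x∈hi′ z∈ z≢x →
        Valid-top v (∈-pair₂ y x) (was-high (Single-move s d) x∈hi′) (M.rest⊆ z∈)
          (λ z∈p → [ (λ { refl → M.rest∉ z∈ (x∈⁅x⁆ y) }) , z≢x ]′ (∈-pair⁻ z∈p))
  in _ , _ , Double-exists d x<y s s′
  where
  y-max : y ∈ˡ hi → ∀ {z} → z ∈ˡ hi ++ lo → z ≢ y → z < y
  y-max y∈hi {z} z∈ z≢y with z ≟ x
  ... | yes refl = x<y
  ... | no  z≢x  = Valid-top v (∈-pair₁ y x) y∈hi z∈ ([ z≢y , z≢x ]′ ∘ ∈-pair⁻)
  -- Using `y` makes only elements above `y` high, and `x` is below it.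
  was-high : ∀ {hi′ lo′} → Move hi lo ⁅ y ⁆ hi′ lo′ → x ∈ˡ hi′ → x ∈ˡ hi
  was-high m x∈hi′ with Move.high m x∈hi′
  ... | inj₁ x∈hi = x∈hi
  ... | inj₂ (w , w∈ , w<x) = contradiction (subst (_< x) (x∈⁅y⁆⇒x≡y y w∈) w<x) (<-asym x<y)

no-valid-[] : ∀ {hi lo : List (Fin n)} → Valid hi lo [] → length (hi ++ lo) ≢ suc k
no-valid-[] {hi = x ∷ hi}       v _ with () ← proj₁ (Valid.covers v (here refl))
no-valid-[] {hi = []} {x ∷ lo}  v _ with () ← proj₁ (Valid.covers v (here refl))

-- The `k` later blocks need `k` of the `suc k` elements, which leaves room for just one in `X`.
block-single : ∀ {hi lo X} {B : Vec (Subset n) k} → Valid hi lo (X ∷ B) →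
  length (hi ++ lo) ≡ suc k → ∃[ x ] X ≡ ⁅ x ⁆
block-single {X = X} v eq with x , x∈X ← Valid.nonempty v zero = x , ≡⁅⁆ x∈X only
  where
  only : ∀ {z} → z ∈ X → z ≡ x
  only {z} z∈X with z ≟ x
  ... | yes z≡x = z≡x
  ... | no  z≢x = contradiction
    (subst (_ ≤_) eq (Valid-packing v (z ∷ x ∷ []) ((z≢x ∷ []) ∷ [] ∷ []) (z∈X ∷ x∈X ∷ [])))
    (ℕ.<-irrefl refl)

block-single-or-pair : ∀ {hi lo X} {B : Vec (Subset n) k} → Valid hi lo (X ∷ B) →
  length (hi ++ lo) ≡ 2 + k → (∃[ x ] X ≡ ⁅ x ⁆) ⊎ (∃₂ λ y x → x < y × X ≡ pair (y , x))
block-single-or-pair {X = X} v eq with x , x∈X ← Valid.nonempty v zero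
  with any? (λ y → (y ∈? X) ×-dec ¬? (y ≟ x))
... | no  alone = inj₁ (x , ≡⁅⁆ x∈X λ {z} z∈X → decidable-stable (z ≟ x) λ z≢x → alone (z , z∈X , z≢x))
... | yes (y , y∈X , y≢x) = inj₂ ordered
  where
  only : ∀ {z} → z ∈ X → z ≡ y ⊎ z ≡ x
  only {z} z∈X with z ≟ y | z ≟ x
  ... | yes z≡y | _       = inj₁ z≡y
  ... | _       | yes z≡x = inj₂ z≡x
  ... | no z≢y  | no z≢x  = contradiction
    (subst (_ ≤_) eq (Valid-packing v (z ∷ y ∷ x ∷ [])
      ((z≢y ∷ z≢x ∷ []) ∷ (y≢x ∷ []) ∷ [] ∷ []) (z∈X ∷ y∈X ∷ x∈X ∷ [])))
    (ℕ.<-irrefl refl)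
  ordered : ∃₂ λ y x → x < y × X ≡ pair (y , x)
  ordered with <-cmp x y
  ... | tri< x<y _ _ = y , x , x<y , ≡pair y∈X x∈X only
  ... | tri≈ _ x≡y _ = contradiction (sym x≡y) y≢x
  ... | tri> _ _ y<x = x , y , y<x , ≡pair x∈X y∈X (swap ∘ only)

gen₀-complete : ∀ k (hi lo : List (Fin n)) {B} → Descending (hi ++ lo) → length (hi ++ lo) ≡ k →
  Valid hi lo B → B ∈ˡ gen₀ k hi lo
gen₀-complete zero    hi lo {[]}    d eq v = here refl
gen₀-complete (suc k) hi lo {X ∷ B} d eq v with x , refl ← block-single v eq
  with hi′ , lo′ , s ← single-complete d v =
  extend⁺ ⁅_⁆ (gen₀ k) (singles-complete s) (gen₀-complete k hi′ lo′ (Single-descending s d)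
    (suc-injective (trans (sym (Single-length s)) eq)) (Valid-∷⁻ (Single-move s d) v))

gen₁-complete : ∀ k (hi lo : List (Fin n)) {B} → Descending (hi ++ lo) → length (hi ++ lo) ≡ suc k →
  Valid hi lo B → B ∈ˡ gen₁ k hi lo
gen₁-complete zero    hi lo {[]}    d eq v = contradiction eq (no-valid-[] v)
gen₁-complete (suc k) hi lo {X ∷ B} d eq v with block-single-or-pair v eq
... | inj₁ (x , refl) with hi′ , lo′ , s ← single-complete d v =
  ∈-++⁺ˡ (extend⁺ ⁅_⁆ (gen₁ k) (singles-complete s) (gen₁-complete k hi′ lo′ (Single-descending s d)
    (suc-injective (trans (sym (Single-length s)) eq)) (Valid-∷⁻ (Single-move s d) v)))
... | inj₂ (y , x , x<y , refl) with hi′ , lo′ , s ← double-complete d x<y v =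
  ∈-++⁺ʳ (extend ⁅_⁆ (gen₁ k) (singles hi lo)) (extend⁺ pair (gen₀ k) (doubles-complete s)
    (gen₀-complete k hi′ lo′ (Double-descending s d)
      (suc-injective (suc-injective (trans (sym (Double-length s)) eq))) (Valid-∷⁻ (Double-move s d) v)))

-- The enumerations have no repetitions

-- The chosen elements serve as keys: distinct keys already make choices distinct, whatever states
-- they leave.
keys-picks : ∀ (hi lo : List (Fin n)) → map proj₁ (picks hi lo) ≡ lo
keys-picks hi []       = refl
keys-picks hi (x ∷ lo) = cong (x ∷_) (keys-picks (hi ∷ʳ x) lo)

Descending⇒Unique : ∀ {xs : List (Fin n)} → Descending xs → Unique xs
Descending⇒Unique = AllPairs.map λ y<x x≡y → <-irrefl (sym x≡y) y<x

singles-unique : ∀ (hi lo : List (Fin n)) → Descending (hi ++ lo) → Unique (map proj₁ (singles hi lo))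
singles-unique []       lo d rewrite keys-picks [] lo = Descending⇒Unique d
singles-unique (h ∷ hi) lo (ps ∷ d) rewrite keys-picks (h ∷ hi) lo =
  Descending⇒Unique (All.++⁻ʳ hi ps ∷ Descending-++⁻ hi d)

withFirst-unique : ∀ (y : Fin n) cs → Unique (map proj₁ cs) → Unique (map proj₁ (withFirst y cs))
withFirst-unique y cs u = subst Unique
  (trans (sym (map-∘ cs)) (map-∘ cs)) (Unique.map⁺ {f = y ,_} (cong proj₂) u)

withFirst-keys : ∀ (y : Fin n) cs {c} → c ∈ˡ map proj₁ (withFirst y cs) → proj₁ c ≡ y
withFirst-keys y cs p with _ , q , refl ← ∈-map⁻ proj₁ p with _ , _ , refl ← ∈-map⁻ _ q = refl

pickPairs-keys : ∀ (hi lo : List (Fin n)) {c} → c ∈ˡ map proj₁ (pickPairs hi lo) → proj₁ c ∈ˡ lo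
pickPairs-keys hi lo p with _ , q , refl ← ∈-map⁻ proj₁ p
  with l₁ , _ , refl , _ ← pickPairs-sound hi lo q = ∈-insert l₁

withFirst-++-unique : ∀ (y : Fin n) cs hi lo → y ∉ˡ lo → Unique (map proj₁ cs) →
  Unique (map proj₁ (pickPairs hi lo)) → Unique (map proj₁ (withFirst y cs ++ pickPairs hi lo))
withFirst-++-unique y cs hi lo y∉ u u′ = subst Unique (sym (map-++ proj₁ (withFirst y cs) (pickPairs hi lo)))
  (Unique.++⁺ (withFirst-unique y cs u) u′ λ (p , q) →
    y∉ (subst (_∈ˡ lo) (withFirst-keys y cs p) (pickPairs-keys hi lo q)))

pickPairs-unique : ∀ (hi lo : List (Fin n)) → Descending lo → Unique (map proj₁ (pickPairs hi lo))
pickPairs-unique hi []       d        = []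
pickPairs-unique hi (y ∷ lo) (ps ∷ d) = withFirst-++-unique y (picks hi lo) (hi ∷ʳ y) lo
  (λ p → <-irrefl refl (All.lookup ps p))
  (subst Unique (sym (keys-picks hi lo)) (Descending⇒Unique d)) (pickPairs-unique (hi ∷ʳ y) lo d)

doubles-unique : ∀ (hi lo : List (Fin n)) → Descending (hi ++ lo) → Unique (map proj₁ (doubles hi lo))
doubles-unique []       lo d        = pickPairs-unique [] lo d
doubles-unique (h ∷ hi) lo (ps ∷ d) = withFirst-++-unique h (singles hi lo) (h ∷ hi) lo
  (λ p → <-irrefl refl (All.lookup ps (∈-++⁺ʳ hi p)))
  (singles-unique hi lo d) (pickPairs-unique (h ∷ hi) lo (Descending-++⁻ hi d))

-- Injectivity of `block` is asked only on members of `cs`: `pair` forgets the order and is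
-- injective just on pairs written with the larger element first.
extend-unique : ∀ (block : K → Subset n) (g : List (Fin n) → List (Fin n) → List (Vec (Subset n) k)) cs →
  Unique (map proj₁ cs) →
  (∀ {c hi lo c′ hi′ lo′} → (c , hi , lo) ∈ˡ cs → (c′ , hi′ , lo′) ∈ˡ cs → block c ≡ block c′ → c ≡ c′) →
  (∀ {c hi lo} → (c , hi , lo) ∈ˡ cs → Unique (g hi lo)) →
  Unique (extend block g cs)
extend-unique block g []                   _        inj gu = []
extend-unique block g ((c , hi , lo) ∷ cs) (c∉ ∷ u) inj gu =
  Unique.++⁺ (Unique.map⁺ ∷-injectiveʳ (gu (here refl)))
    (extend-unique block g cs u (λ p q → inj (there p) (there q)) (gu ∘ there))
    disj
  where
  disj : Disjoint (map (block c ∷_) (g hi lo)) (extend block g cs)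
  disj (p , q) with B , _ , refl ← ∈-map⁻ (block c ∷_) p
    with c′ , hi′ , lo′ , r , _ , eq ← extend⁻ block g cs q =
    All.lookup c∉ (∈-map⁺ proj₁ r) (inj (here refl) (there r) eq)

⁅⁆-injective : ∀ {x y : Fin n} → ⁅ x ⁆ ≡ ⁅ y ⁆ → x ≡ y
⁅⁆-injective {x = x} {y} eq = x∈⁅y⁆⇒x≡y y (subst (x ∈_) eq (x∈⁅x⁆ x))

⁅⁆≢pair : ∀ {z y x : Fin n} → x < y → ⁅ z ⁆ ≢ pair (y , x)
⁅⁆≢pair {z = z} {y} {x} x<y eq = <-irrefl (trans (lies (∈-pair₂ y x)) (sym (lies (∈-pair₁ y x)))) x<y
  where
  lies : ∀ {w} → w ∈ pair (y , x) → w ≡ z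
  lies w∈ = x∈⁅y⁆⇒x≡y z (subst (_ ∈_) (sym eq) w∈)

pair-injective : ∀ {y x y′ x′ : Fin n} → x < y → x′ < y′ →
  pair (y , x) ≡ pair (y′ , x′) → (y , x) ≡ (y′ , x′)
pair-injective {y = y} {x} {y′} {x′} x<y x′<y′ eq
  with ∈-pair⁻ (subst (y ∈_) eq (∈-pair₁ y x)) | ∈-pair⁻ (subst (x ∈_) eq (∈-pair₂ y x))
... | inj₁ refl | inj₁ refl = contradiction x<y (<-irrefl refl)
... | inj₁ refl | inj₂ refl = refl
... | inj₂ refl | inj₁ refl = contradiction x′<y′ (<-asym x<y)
... | inj₂ refl | inj₂ refl = contradiction x<y (<-irrefl refl)

gen₀-unique : ∀ k (hi lo : List (Fin n)) → Descending (hi ++ lo) → Unique (gen₀ k hi lo)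
gen₀-unique zero    hi lo d = [] ∷ []
gen₀-unique (suc k) hi lo d = extend-unique ⁅_⁆ (gen₀ k) (singles hi lo) (singles-unique hi lo d)
  (λ _ _ → ⁅⁆-injective)
  (λ {c} {hi′} {lo′} p → gen₀-unique k hi′ lo′ (Single-descending (singles-sound hi lo p) d))

gen₁-unique : ∀ k (hi lo : List (Fin n)) → Descending (hi ++ lo) → Unique (gen₁ k hi lo)
gen₁-unique zero    hi lo d = []
gen₁-unique (suc k) hi lo d = Unique.++⁺
  (extend-unique ⁅_⁆ (gen₁ k) (singles hi lo) (singles-unique hi lo d)
    (λ _ _ → ⁅⁆-injective)
    (λ {c} {hi′} {lo′} p → gen₁-unique k hi′ lo′ (Single-descending (singles-sound hi lo p) d)))
  (extend-unique pair (gen₀ k) (doubles hi lo) (doubles-unique hi lo d)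
    (λ p q → pair-injective (Double-< (doubles-sound hi lo p) d) (Double-< (doubles-sound hi lo q) d))
    (λ {c} {hi′} {lo′} p → gen₀-unique k hi′ lo′ (Double-descending (doubles-sound hi lo p) d)))
  disj
  where
  disj : Disjoint (extend ⁅_⁆ (gen₁ k) (singles hi lo)) (extend pair (gen₀ k) (doubles hi lo))
  disj {X ∷ B} (p , q) with _ , _ , _ , _ , _ , refl ← extend⁻ ⁅_⁆ (gen₁ k) (singles hi lo) p
    with _ , _ , _ , r , _ , eq ← extend⁻ pair (gen₀ k) (doubles hi lo) q =
    ⁅⁆≢pair (Double-< (doubles-sound hi lo r) d) eq

-- Ordered partitions of the whole ground set

descending : ∀ n → List (Fin n)
descending n = tabulate opposite

descending-descending : ∀ n → Descending (descending n)
descending-descending n = AllPairs.tabulate⁺-< λ {i} {j} i<j →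
  subst₂ ℕ._<_ (sym (opposite-prop j)) (sym (opposite-prop i)) (ℕ.∸-monoʳ-< (s≤s i<j) (toℕ<n j))

∈-descending : ∀ (x : Fin n) → x ∈ˡ descending n
∈-descending {n} x = subst (_∈ˡ descending n) (opposite-involutive x) (∈-tabulate⁺ (opposite x))

increasing⁺ : ∀ {i j l : Fin n} → i < j → j < l → Increasing (i ∷ j ∷ l ∷ [])
increasing⁺ i<j j<l zero zero ()
increasing⁺ i<j j<l zero (suc zero)       _ = i<j
increasing⁺ i<j j<l zero (suc (suc zero)) _ = <-trans i<j j<l
increasing⁺ i<j j<l (suc zero) (suc (suc zero)) _ = j<l
increasing⁺ i<j j<l (suc zero) (suc zero) (s≤s ())
increasing⁺ i<j j<l (suc (suc zero)) (suc zero) (s≤s ())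
increasing⁺ i<j j<l (suc (suc zero)) (suc (suc zero)) (s≤s (s≤s ()))

increasing⇒orderIsomorphic : ∀ {m} {bs : Vec (Fin n) m} → Increasing bs → OrderIsomorphic bs Permutation.id
increasing⇒orderIsomorphic {bs = bs} inc a c = mk⇔ reflect (inc a c)
  where
  reflect : lookup bs a < lookup bs c → a < c
  reflect lt with <-cmp a c
  ... | tri< a<c _ _ = a<c
  ... | tri≈ _ refl _ = contradiction lt (<-irrefl refl)
  ... | tri> _ _ c<a = contradiction lt (<-asym (inc c a c<a))

module _ {B : Vec (Subset n) k} where

  -- Before any block is used nothing is high, so validity amounts to being an ordered partition
  -- that avoids 123.
  Valid⇒partition : Valid [] (descending n) B → IsOrderedPartition B × Avoids pattern123 B
  Valid⇒partition v = record
    { nonempty = V.nonempty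
    ; disjoint = λ i j i≢j (x , x∈) → let p , q = x∈p∩q⁻ (lookup B i) (lookup B j) x∈ in V.disjoint i j i≢j p q
    ; covers   = λ x → V.covers (∈-descending x)
    } , λ { (i ∷ j ∷ l ∷ [] , x ∷ y ∷ z ∷ [] , inc , mem , iso) →
      V.no123 (inc zero (suc zero) (s≤s z≤n)) (inc (suc zero) (suc (suc zero)) (s≤s (s≤s z≤n)))
        (mem zero) (mem (suc zero)) (mem (suc (suc zero)))
        (Equivalence.from (iso zero (suc zero)) (s≤s z≤n))
        (Equivalence.from (iso (suc zero) (suc (suc zero))) (s≤s (s≤s z≤n))) }
    where module V = Valid v

  partition⇒Valid : IsOrderedPartition B × Avoids pattern123 B → Valid [] (descending n) B
  partition⇒Valid (P , avoids) = record
    { nonempty = P.nonempty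
    ; disjoint = λ i j i≢j p q → P.disjoint i j i≢j (_ , x∈p∩q⁺ (p , q))
    ; sound    = λ _ _ → ∈-descending _
    ; covers   = λ {x} _ → P.covers x
    ; no12     = λ _ _ _ _ ()
    ; no123    = λ {i} {j} {l} {x} {y} {z} i<j j<l p q r x<y y<z → avoids
        ( i ∷ j ∷ l ∷ [] , x ∷ y ∷ z ∷ []
        , increasing⁺ i<j j<l
        , (λ { zero → p ; (suc zero) → q ; (suc (suc zero)) → r })
        , increasing⇒orderIsomorphic {bs = x ∷ y ∷ z ∷ []} (increasing⁺ x<y y<z) )
    }
    where module P = IsOrderedPartition P

-- From the enumeration to the formula

-- Two lists without repetitions that have the same members are permutations of each other.
length-filter-unique : ∀ {A : Set} {P : A → Set} (P? : Decidable P) {xs ys : List A} →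
  Unique xs → Unique ys → (∀ v → v ∈ˡ xs) → (∀ {v} → P v ⇔ v ∈ˡ ys) → length (filter P? xs) ≡ length ys
length-filter-unique P? {xs} u u′ all P⇔ = ↭-length (∼bag⇒↭ (unique∧set⇒bag (Unique.filter⁺ P? u) u′
  (mk⇔ (λ p → Equivalence.to P⇔ (proj₂ (∈-filter⁻ P? {xs = xs} p)))
       (λ p → ∈-filter⁺ P? (all _) (Equivalence.from P⇔ p)))))

-- At the start all m + 1 elements are low, so the state is (0,m+1).
op≡count₁ : ∀ m → op (suc m) m pattern123 ≡ count₁ m 0 (suc m)
op≡count₁ m = trans
  (length-filter-unique (λ B → isOrderedPartition? B ×-dec avoids? pattern123 B)
    (candidates-unique (suc m) m) (gen₁-unique m [] w d) candidates-complete
    (mk⇔ (λ P → gen₁-complete m [] w d w-length (partition⇒Valid P))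
         (λ p → Valid⇒partition (gen₁-sound m [] w d w-length p))))
  (trans (length-gen₁ m [] w) (cong (count₁ m 0) w-length))
  where
  w : List (Fin (suc m))
  w = descending (suc m)
  d : Descending w
  d = descending-descending (suc m)
  w-length : length w ≡ suc m
  w-length = length-tabulate opposite

-- Opened only here because +_ makes sections such as (x +_) ambiguous.
open import Data.Integer using (+_)

-- Both quotients are normalisations of unnormalised rationals, for which equality is cross
-- multiplication.
/1-≡-/ : ∀ x y d .{{_ : NonZero d}} → d * x ≡ y → + x / 1 ≡ + y / d
/1-≡-/ x y d@(suc d-1) eq = fromℚᵘ-cong {mkℚᵘ (+ x) 0} {mkℚᵘ (+ y) d-1} (*≡* (begin
  + x ℤ.* + d   ≡⟨ ℤ.pos-* x d ⟨
  + (x * d)     ≡⟨ cong +_ (trans (ℕ.*-comm x d) eq) ⟩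
  + y           ≡⟨ ℤ.*-identityʳ (+ y) ⟨
  + y ℤ.* + 1   ∎))

theorem4 : (n : ℕ) .{{_ : NonZero n}} →
    (+ op n (n ∸ 1) pattern123) / 1
    ≡ _/_ (+ (3 * (n ∸ 1) ^ 2 * ((2 * n ∸ 2) C (n ∸ 1)))) (n * suc n) {{m*n≢0 n (suc n)}}
theorem4 (suc m) = /1-≡-/ (op (suc m) m pattern123) (3 * m ^ 2 * ((2 * suc m ∸ 2) C m)) (suc m * (2 + m)) (begin
  suc m * (2 + m) * op (suc m) m pattern123  ≡⟨ cong (suc m * (2 + m) *_) (op≡count₁ m) ⟩
  suc m * (2 + m) * count₁ m 0 (suc m)       ≡⟨ count₁-closed m ⟩
  3 * m ^ 2 * ((m + m) C m)                  ≡⟨ cong (λ t → 3 * m ^ 2 * (t C m)) 2m ⟨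
  3 * m ^ 2 * ((2 * suc m ∸ 2) C m)          ∎)
  where
  2m : 2 * suc m ∸ 2 ≡ m + m
  2m = trans (cong (_∸ 1) (ℕ.+-suc m (m + 0))) (cong (λ t → m + t) (ℕ.+-identityʳ m))
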